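{- Let $a,b,m\in\mathbb{N}$, and for $j\ge0$ set $A_j:=a+jm$, $B_j:=b+jm$, $C_j:=a+b+jm$. Then, as formal power series in $q$, $$F_{a,b,m}(q)=\prod_{j\ge0}R_{A_j,B_j}(q)\;\prod_{j\ge0}\bigl(1+q^{C_{2j+1}}\bigr),$$ where the infinite products converge coefficientwise.
   Context: $\mathbb{N}$ is the set of positive integers. Notation: $(z;q)_\infty=\prod_{i\ge0}(1-zq^i)$. For $a,b,m\in\mathbb{N}$, $$F_{a,b,m}(q):=\frac{(-q^{a+b};q^m)_\infty}{(-q^a;q^m)_\infty\,(q^b;q^m)_\infty}.$$ For $A,B\in\mathbb{N}$, $$R_{A,B}(q):=\frac{1+q^{A+B}}{(1+q^A)(1-q^B)}.$$ All quotients are expanded as formal power series in $q$. -}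

module Defs where

import Algebra.Properties.CommutativeMonoid.Sum as Sum
open import Data.Fin.Base using (toℕ)
open import Data.Fin.Properties using (toℕ<n)
open import Data.Integer.Base as ℤ using (ℤ; 0ℤ; 1ℤ)
import Data.Integer.Properties as ℤ
open import Data.Nat.Base as ℕ using (ℕ; zero; suc; NonZero; _≤_; _<_; _∸_; s<s)
import Data.Nat.Properties as ℕ
open import Data.Product.Base using (Σ-syntax; _,_; proj₁)
open import Relation.Binary.PropositionalEquality

open Sum ℤ.+-0-commutativeMonoid using (sum; sum-cong-≗)

infix  4 _≈_
infixl 6 _+_ _-_
infixl 7 _*_ _/_[_]
infix  8 -_
infixr 9 _^_

-- Formal power series with integer coefficients, as coefficient sequences.
PowerSeries : Set
PowerSeries = ℕ → ℤ

_≈_ : PowerSeries → PowerSeries → Set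
_≈_ = _≗_

1# : PowerSeries
1# zero    = 1ℤ
1# (suc _) = 0ℤ

q : PowerSeries
q zero    = 0ℤ
q (suc n) = 1# n

_+_ _-_ _*_ : PowerSeries → PowerSeries → PowerSeries
(f + g) n = f n ℤ.+ g n
(f - g) n = f n ℤ.- g n
(f * g) n = sum {suc n} λ i → f (toℕ i) ℤ.* g (n ∸ toℕ i)

-_ : PowerSeries → PowerSeries
(- f) n = ℤ.- f n

_^_ : PowerSeries → ℕ → PowerSeries
f ^ zero  = 1#
f ^ suc n = f * f ^ n

-- The quotient by a series with constant term 1, by long division:
-- if f = h g and g₀ = 1 then h₀ = f₀, and (h - h₀)/q is the quotient of
-- (f - f₀ g)/q by g.  See /-* below.
_/_[_] : (f g : PowerSeries) → .(g 0 ≡ 1ℤ) → PowerSeries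
(f / g [ g₀ ]) zero    = f 0
(f / g [ g₀ ]) (suc n) = ((λ k → f (suc k) ℤ.- f 0 ℤ.* g (suc k)) / g [ g₀ ]) n

/-* : ∀ f g (g₀ : g 0 ≡ 1ℤ) → f / g [ g₀ ] * g ≈ f
/-* f g g₀ zero = begin
  f 0 ℤ.* g 0 ℤ.+ 0ℤ ≡⟨ ℤ.+-identityʳ _ ⟩
  f 0 ℤ.* g 0        ≡⟨ cong (f 0 ℤ.*_) g₀ ⟩
  f 0 ℤ.* 1ℤ         ≡⟨ ℤ.*-identityʳ _ ⟩
  f 0                ∎
  where open ≡-Reasoning
/-* f g g₀ (suc n) = begin
  x ℤ.+ (h / g [ g₀ ] * g) n    ≡⟨ cong (λ y → x ℤ.+ y) (/-* h g g₀ n) ⟩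
  x ℤ.+ (f (suc n) ℤ.- x)       ≡⟨ cong (λ y → x ℤ.+ y) (ℤ.+-comm (f (suc n)) (ℤ.- x)) ⟩
  x ℤ.+ (ℤ.- x ℤ.+ f (suc n))   ≡⟨ ℤ.+-assoc x (ℤ.- x) (f (suc n)) ⟨
  x ℤ.- x ℤ.+ f (suc n)         ≡⟨ cong (ℤ._+ f (suc n)) (ℤ.+-inverseʳ x) ⟩
  0ℤ ℤ.+ f (suc n)              ≡⟨ ℤ.+-identityˡ _ ⟩
  f (suc n)                     ∎
  where
  open ≡-Reasoning
  x = f 0 ℤ.* g (suc n)
  h : PowerSeries
  h k = f (suc k) ℤ.- f 0 ℤ.* g (suc k)

-- ∏< N f = f 0 * ⋯ * f (N - 1)
∏< : ℕ → (ℕ → PowerSeries) → PowerSeries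
∏< zero    f = 1#
∏< (suc N) f = ∏< N f * f N

-- Coefficientwise convergence: each coefficient of the partial products is
-- eventually constant.
ProductConverges : (ℕ → PowerSeries) → Set
ProductConverges f = ∀ n → Σ[ N ∈ ℕ ] (∀ M → N ≤ M → ∏< M f n ≡ ∏< N f n)

∏∞ : (f : ℕ → PowerSeries) → ProductConverges f → PowerSeries
∏∞ f conv n = ∏< (proj₁ (conv n)) f n

*-cong-≤ : ∀ {f f′ g g′} n → (∀ k → k ≤ n → f k ≡ f′ k) →
           (∀ k → k ≤ n → g k ≡ g′ k) → (f * g) n ≡ (f′ * g′) n
*-cong-≤ n f≡ g≡ = sum-cong-≗ {suc n} λ i →
  cong₂ ℤ._*_ (f≡ (toℕ i) (ℕ.≤-pred (toℕ<n i))) (g≡ (n ∸ toℕ i) (ℕ.m∸n≤m n (toℕ i)))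

*-identityʳ : ∀ f → f * 1# ≈ f
*-identityʳ f zero    = trans (ℤ.+-identityʳ _) (ℤ.*-identityʳ (f 0))
*-identityʳ f (suc n) = begin
  f 0 ℤ.* 0ℤ ℤ.+ ((λ k → f (suc k)) * 1#) n ≡⟨ cong₂ ℤ._+_ (ℤ.*-zeroʳ (f 0)) (*-identityʳ (λ k → f (suc k)) n) ⟩
  0ℤ ℤ.+ f (suc n)                          ≡⟨ ℤ.+-identityˡ _ ⟩
  f (suc n)                                 ∎
  where open ≡-Reasoning

*-const : ∀ f g → (f * g) 0 ≡ f 0 ℤ.* g 0
*-const f g = ℤ.+-identityʳ _

*-vanishes : ∀ f {g i} → (∀ k → k < i → g k ≡ 0ℤ) → ∀ k → k < i → (f * g) k ≡ 0ℤ
*-vanishes f {g} g≡0 zero k<i =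
  trans (*-const f g) (trans (cong (f 0 ℤ.*_) (g≡0 0 k<i)) (ℤ.*-zeroʳ (f 0)))
*-vanishes f {g} g≡0 (suc k) k<i = cong₂ ℤ._+_
  (trans (cong (f 0 ℤ.*_) (g≡0 (suc k) k<i)) (ℤ.*-zeroʳ (f 0)))
  (*-vanishes (λ j → f (suc j)) g≡0 k (ℕ.<-trans (ℕ.n<1+n k) k<i))

^-vanishes : ∀ {w} → w 0 ≡ 0ℤ → ∀ i k → k < i → (w ^ i) k ≡ 0ℤ
^-vanishes {w} w₀ (suc i) zero    _         =
  trans (*-const w (w ^ i)) (cong (ℤ._* (w ^ i) 0) w₀)
^-vanishes {w} w₀ (suc i) (suc k) (s<s k<i) = cong₂ ℤ._+_
  (cong (ℤ._* (w ^ i) (suc k)) w₀)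
  (*-vanishes (λ j → w (suc j)) (^-vanishes w₀ i) k k<i)

∏-converges : ∀ f → (∀ i k → k < i → f i k ≡ 1# k) → ProductConverges f
∏-converges f f≡1 n = suc n , λ M n<M → stable (ℕ.≤⇒≤′ n<M)
  where
  stable : ∀ {M} → suc n ℕ.≤′ M → ∏< M f n ≡ ∏< (suc n) f n
  stable (ℕ.≤′-reflexive refl)   = refl
  stable (ℕ.≤′-step {M} n<M) = begin
    (∏< M f * f M) n ≡⟨ *-cong-≤ {∏< M f} n (λ _ _ → refl)
                          (λ k k≤n → f≡1 M k (ℕ.≤-<-trans k≤n (ℕ.≤′⇒≤ n<M))) ⟩
    (∏< M f * 1#) n  ≡⟨ *-identityʳ (∏< M f) n ⟩
    ∏< M f n         ≡⟨ stable n<M ⟩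
    ∏< (suc n) f n   ∎
    where open ≡-Reasoning

*-const-1 : ∀ {f g} → f 0 ≡ 1ℤ → g 0 ≡ 1ℤ → (f * g) 0 ≡ 1ℤ
*-const-1 {f} {g} f₀ g₀ = trans (*-const f g) (cong₂ ℤ._*_ f₀ g₀)

∏∞-const-1 : ∀ f conv → (∀ i → f i 0 ≡ 1ℤ) → ∏∞ f conv 0 ≡ 1ℤ
∏∞-const-1 f conv f₀ = partial (proj₁ (conv 0))
  where
  partial : ∀ N → ∏< N f 0 ≡ 1ℤ
  partial zero    = refl
  partial (suc N) = *-const-1 {∏< N f} {f N} (partial N) (f₀ N)

module _ (z w : PowerSeries) (w₀ : w 0 ≡ 0ℤ) where

  qPochhammer-converges : ProductConverges (λ i → 1# - z * w ^ i)
  qPochhammer-converges = ∏-converges _ λ i k k<i →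
    trans (cong (ℤ._-_ (1# k)) (*-vanishes z (^-vanishes w₀ i) k k<i)) (ℤ.+-identityʳ _)

  -- (z; w)∞, where w has zero constant term.
  qPochhammer : PowerSeries
  qPochhammer = ∏∞ (λ i → 1# - z * w ^ i) qPochhammer-converges

  qPochhammer-const : z 0 ≡ 0ℤ → qPochhammer 0 ≡ 1ℤ
  qPochhammer-const z₀ = ∏∞-const-1 _ qPochhammer-converges λ i →
    cong (ℤ._-_ 1ℤ) (trans (*-const z (w ^ i)) (cong (ℤ._* (w ^ i) 0) z₀))

q^-const : ∀ n .{{_ : NonZero n}} → (q ^ n) 0 ≡ 0ℤ
q^-const (suc n) = *-const q (q ^ n)

-q^-const : ∀ n .{{_ : NonZero n}} → (- (q ^ n)) 0 ≡ 0ℤ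
-q^-const n = cong ℤ.-_ (q^-const n)

F : (a b m : ℕ) .{{_ : NonZero a}} .{{_ : NonZero b}} .{{_ : NonZero m}} → PowerSeries
F a b m =
  ⟨ - (q ^ (a ℕ.+ b)) ⟩∞ / ⟨ - (q ^ a) ⟩∞ * ⟨ q ^ b ⟩∞ [ const ]
  where
  ⟨_⟩∞ : PowerSeries → PowerSeries
  ⟨ z ⟩∞ = qPochhammer z (q ^ m) (q^-const m)

  const : (⟨ - (q ^ a) ⟩∞ * ⟨ q ^ b ⟩∞) 0 ≡ 1ℤ
  const = *-const-1 {⟨ - (q ^ a) ⟩∞} {⟨ q ^ b ⟩∞}
    (qPochhammer-const (- (q ^ a)) (q ^ m) (q^-const m) (-q^-const a))
    (qPochhammer-const (q ^ b) (q ^ m) (q^-const m) (q^-const b))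

R : (A B : ℕ) .{{_ : NonZero A}} .{{_ : NonZero B}} → PowerSeries
R A B = (1# + q ^ (A ℕ.+ B)) / ((1# + q ^ A) * (1# - q ^ B)) [ const ]
  where
  const : ((1# + q ^ A) * (1# - q ^ B)) 0 ≡ 1ℤ
  const = *-const-1 {1# + q ^ A} {1# - q ^ B}
    (cong (ℤ._+_ 1ℤ) (q^-const A)) (cong (ℤ._-_ 1ℤ) (q^-const B))

instance
  +-nonZero : ∀ {m n} .{{_ : NonZero m}} → NonZero (m ℕ.+ n)
  +-nonZero {suc m} = _

{-# OPTIONS --safe #-}
module Submission where

-- Cut off at degree n, every infinite product agrees with a partial product
-- of length M > n.  For partial products, multiplying Rⱼ by its denominator
-- leaves 1 + q^(Aⱼ + Bⱼ) = 1 + q^(C₂ⱼ), and interleaving with 1 + q^(C₂ⱼ₊₁)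
-- gives the first 2M factors of (- q^(a+b); q^m)∞.  So the right-hand side
-- times the denominator of F is the numerator of F, and the denominator,
-- having constant term 1, can be cancelled.

open import Defs
open import Algebra.Bundles using (CommutativeMonoid)
import Algebra.Properties.CommutativeSemigroup as CommutativeSemigroupProperties
open import Algebra.Structures using (IsCommutativeMonoid)
open import Data.Integer.Base as ℤ using (0ℤ; 1ℤ)
import Data.Integer.Properties as ℤ
open import Data.Integer.Tactic.RingSolver using (solve-∀)
open import Data.Nat.Base as ℕ using (ℕ; zero; suc; NonZero; _≤_; _<_; s≤s)
import Data.Nat.Properties as ℕ
import Data.Nat.Tactic.RingSolver as ℕSolver
open import Data.Product.Base using (Σ-syntax; _,_; proj₂)
open import Level using (0ℓ)
open import Relation.Binary.PropositionalEquality
  using (_≡_; refl; sym; trans; cong; cong₂; module ≡-Reasoning)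
import Relation.Binary.Reasoning.Setoid as SetoidReasoning

-- Power series as a commutative monoid under the Cauchy product.

tail : PowerSeries → PowerSeries
tail f n = f (suc n)

*-cong : ∀ {f f′ g g′} → f ≈ f′ → g ≈ g′ → f * g ≈ f′ * g′
*-cong {f} f≈ g≈ n = *-cong-≤ {f} n (λ k _ → f≈ k) (λ k _ → g≈ k)

-- The combination c f + g is the shape of `tail (f * g)`, which is `f 0` times `tail g` plus
-- `tail f * g`. Linearity in this form carries the induction step of `*-assoc`.
*-linearˡ : ∀ c f g h n →
            ((λ k → c ℤ.* f k ℤ.+ g k) * h) n ≡ c ℤ.* (f * h) n ℤ.+ (g * h) n
*-linearˡ c f g h zero    = lemma c (f 0) (g 0) (h 0)
  where
  lemma : ∀ c x y z → (c ℤ.* x ℤ.+ y) ℤ.* z ℤ.+ 0ℤ ≡ c ℤ.* (x ℤ.* z ℤ.+ 0ℤ) ℤ.+ (y ℤ.* z ℤ.+ 0ℤ)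
  lemma = solve-∀
*-linearˡ c f g h (suc n) = trans
  (cong (ℤ._+_ ((c ℤ.* f 0 ℤ.+ g 0) ℤ.* h (suc n))) (*-linearˡ c (tail f) (tail g) h n))
  (lemma c (f 0) (g 0) (h (suc n)) ((tail f * h) n) ((tail g * h) n))
  where
  lemma : ∀ c x y z s t → (c ℤ.* x ℤ.+ y) ℤ.* z ℤ.+ (c ℤ.* s ℤ.+ t) ≡
                          c ℤ.* (x ℤ.* z ℤ.+ s) ℤ.+ (y ℤ.* z ℤ.+ t)
  lemma = solve-∀

*-negˡ : ∀ f g → (- f) * g ≈ - (f * g)
*-negˡ f g zero    = lemma (f 0) (g 0)
  where
  lemma : ∀ x y → ℤ.- x ℤ.* y ℤ.+ 0ℤ ≡ ℤ.- (x ℤ.* y ℤ.+ 0ℤ)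
  lemma = solve-∀
*-negˡ f g (suc n) = trans
  (cong (ℤ._+_ (ℤ.- f 0 ℤ.* g (suc n))) (*-negˡ (tail f) g n))
  (lemma (f 0) (g (suc n)) ((tail f * g) n))
  where
  lemma : ∀ x y s → ℤ.- x ℤ.* y ℤ.+ ℤ.- s ≡ ℤ.- (x ℤ.* y ℤ.+ s)
  lemma = solve-∀

-- The convolution sum unfolds from its first summand; this splits off the last one instead.
-- `*-comm` plays the two expansions against each other.
*-sucʳ : ∀ f g n → (f * g) (suc n) ≡ (f * tail g) n ℤ.+ f (suc n) ℤ.* g 0
*-sucʳ f g zero    = lemma (f 0 ℤ.* g 1) (f 1 ℤ.* g 0)
  where
  lemma : ∀ x y → x ℤ.+ (y ℤ.+ 0ℤ) ≡ x ℤ.+ 0ℤ ℤ.+ y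
  lemma = solve-∀
*-sucʳ f g (suc n) = trans
  (cong (ℤ._+_ (f 0 ℤ.* g (suc (suc n)))) (*-sucʳ (tail f) g n))
  (sym (ℤ.+-assoc (f 0 ℤ.* g (suc (suc n))) ((tail f * tail g) n) (f (suc (suc n)) ℤ.* g 0)))

*-comm : ∀ f g → f * g ≈ g * f
*-comm f g zero    = cong (ℤ._+ 0ℤ) (ℤ.*-comm (f 0) (g 0))
*-comm f g (suc n) = begin
  f 0 ℤ.* g (suc n) ℤ.+ (tail f * g) n ≡⟨ ℤ.+-comm (f 0 ℤ.* g (suc n)) ((tail f * g) n) ⟩
  (tail f * g) n ℤ.+ f 0 ℤ.* g (suc n) ≡⟨ cong₂ ℤ._+_ (*-comm (tail f) g n) (ℤ.*-comm (f 0) (g (suc n))) ⟩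
  (g * tail f) n ℤ.+ g (suc n) ℤ.* f 0 ≡⟨ *-sucʳ g f n ⟨
  (g * f) (suc n)                      ∎
  where open ≡-Reasoning

*-assoc : ∀ f g h → (f * g) * h ≈ f * (g * h)
*-assoc f g h zero    = lemma (f 0) (g 0) (h 0)
  where
  lemma : ∀ x y z → (x ℤ.* y ℤ.+ 0ℤ) ℤ.* z ℤ.+ 0ℤ ≡ x ℤ.* (y ℤ.* z ℤ.+ 0ℤ) ℤ.+ 0ℤ
  lemma = solve-∀
*-assoc f g h (suc n) = begin
  (f * g) 0 ℤ.* h (suc n) ℤ.+ (tail (f * g) * h) n
    -- `tail (f * g)` reduces to the combination required by `*-linearˡ`, with scalar `f 0`.
    ≡⟨ cong₂ (λ x y → x ℤ.* h (suc n) ℤ.+ y) (*-const f g) (*-linearˡ (f 0) (tail g) (tail f * g) h n) ⟩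
  f 0 ℤ.* g 0 ℤ.* h (suc n) ℤ.+ (f 0 ℤ.* (tail g * h) n ℤ.+ ((tail f * g) * h) n)
    ≡⟨ cong (λ x → f 0 ℤ.* g 0 ℤ.* h (suc n) ℤ.+ (f 0 ℤ.* (tail g * h) n ℤ.+ x)) (*-assoc (tail f) g h n) ⟩
  f 0 ℤ.* g 0 ℤ.* h (suc n) ℤ.+ (f 0 ℤ.* (tail g * h) n ℤ.+ (tail f * (g * h)) n)
    ≡⟨ lemma (f 0) (g 0) (h (suc n)) ((tail g * h) n) ((tail f * (g * h)) n) ⟩
  (f * (g * h)) (suc n) ∎
  where
  open ≡-Reasoning
  lemma : ∀ x y z s t → x ℤ.* y ℤ.* z ℤ.+ (x ℤ.* s ℤ.+ t) ≡ x ℤ.* (y ℤ.* z ℤ.+ s) ℤ.+ t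
  lemma = solve-∀

*-identityˡ : ∀ f → 1# * f ≈ f
*-identityˡ f n = trans (*-comm 1# f n) (*-identityʳ f n)

-- Packaged to obtain setoid reasoning and the rearrangements `interchange` and `xy∙z≈xz∙y`.
*-1#-isCommutativeMonoid : IsCommutativeMonoid _≈_ _*_ 1#
*-1#-isCommutativeMonoid = record
  { isMonoid = record
    { isSemigroup = record
      { isMagma = record
        { isEquivalence = record
          { refl  = λ _ → refl
          ; sym   = λ f≈g n → sym (f≈g n)
          ; trans = λ f≈g g≈h n → trans (f≈g n) (g≈h n)
          }
        ; ∙-cong = λ {f} → *-cong {f}
        }
      ; assoc = *-assoc
      }
    ; identity = *-identityˡ , *-identityʳ
    }
  ; comm = *-comm
  }

*-1#-commutativeMonoid : CommutativeMonoid 0ℓ 0ℓ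
*-1#-commutativeMonoid = record { isCommutativeMonoid = *-1#-isCommutativeMonoid }

open CommutativeMonoid *-1#-commutativeMonoid using (setoid; commutativeSemigroup)
open CommutativeSemigroupProperties commutativeSemigroup using (interchange; xy∙z≈xz∙y)
module ≈-Reasoning = SetoidReasoning setoid

*-congˡ : ∀ f {g g′} → g ≈ g′ → f * g ≈ f * g′
*-congˡ f = *-cong {f} (λ _ → refl)

*-congʳ : ∀ {f f′} g → f ≈ f′ → f * g ≈ f′ * g
*-congʳ {f} g f≈ = *-cong {f} {g = g} f≈ (λ _ → refl)

-- The constant term 1 makes `g` invertible, with inverse `1# / g [ g₀ ]`; multiply both sides by
-- it.
*-cancelʳ : ∀ {f h} g → g 0 ≡ 1ℤ → f * g ≈ h * g → f ≈ h
*-cancelʳ {f} {h} g g₀ fg≈hg = begin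
  f                         ≈⟨ expand f ⟨
  (f * g) * (1# / g [ g₀ ]) ≈⟨ *-congʳ {f * g} (1# / g [ g₀ ]) fg≈hg ⟩
  (h * g) * (1# / g [ g₀ ]) ≈⟨ expand h ⟩
  h                         ∎
  where
  open ≈-Reasoning
  expand : ∀ f → (f * g) * (1# / g [ g₀ ]) ≈ f
  expand f = begin
    (f * g) * (1# / g [ g₀ ]) ≈⟨ *-assoc f g (1# / g [ g₀ ]) ⟩
    f * (g * (1# / g [ g₀ ])) ≈⟨ *-congˡ f (*-comm g (1# / g [ g₀ ])) ⟩
    f * (1# / g [ g₀ ] * g)   ≈⟨ *-congˡ f (/-* 1# g g₀) ⟩
    f * 1#                    ≈⟨ *-identityʳ f ⟩
    f                         ∎

-- Powers and finite products.

^-distribˡ-+-* : ∀ f m n → f ^ (m ℕ.+ n) ≈ f ^ m * f ^ n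
^-distribˡ-+-* f zero    n = λ k → sym (*-identityˡ (f ^ n) k)
^-distribˡ-+-* f (suc m) n = begin
  f * f ^ (m ℕ.+ n)     ≈⟨ *-congˡ f (^-distribˡ-+-* f m n) ⟩
  f * (f ^ m * f ^ n)   ≈⟨ *-assoc f (f ^ m) (f ^ n) ⟨
  f * f ^ m * f ^ n     ∎
  where open ≈-Reasoning

^-*-assoc : ∀ f m n → f ^ (n ℕ.* m) ≈ (f ^ m) ^ n
^-*-assoc f m zero    = λ _ → refl
^-*-assoc f m (suc n) = begin
  f ^ (m ℕ.+ n ℕ.* m)    ≈⟨ ^-distribˡ-+-* f m (n ℕ.* m) ⟩
  f ^ m * f ^ (n ℕ.* m)  ≈⟨ *-congˡ (f ^ m) (^-*-assoc f m n) ⟩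
  f ^ m * (f ^ m) ^ n    ∎
  where open ≈-Reasoning

∏<-cong : ∀ M {f g} → (∀ j → f j ≈ g j) → ∏< M f ≈ ∏< M g
∏<-cong zero            f≈g = λ _ → refl
∏<-cong (suc M) {f} {g} f≈g = *-cong {∏< M f} (∏<-cong M f≈g) (f≈g M)

∏<-distrib-* : ∀ M f g → ∏< M (λ j → f j * g j) ≈ ∏< M f * ∏< M g
∏<-distrib-* zero    f g = λ n → sym (*-identityˡ 1# n)
∏<-distrib-* (suc M) f g = begin
  ∏< M (λ j → f j * g j) * (f M * g M)  ≈⟨ *-congʳ {∏< M (λ j → f j * g j)} (f M * g M) (∏<-distrib-* M f g) ⟩
  (∏< M f * ∏< M g) * (f M * g M)       ≈⟨ interchange (∏< M f) (∏< M g) (f M) (g M) ⟩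
  (∏< M f * f M) * (∏< M g * g M)       ∎
  where open ≈-Reasoning

-- The factor 2 stands on the right because `suc M ℕ.* 2` reduces to `suc (suc (M ℕ.* 2))`, so the
-- longer product unfolds by exactly two factors.
∏<-pairs : ∀ M f → ∏< M (λ j → f (j ℕ.* 2) * f (suc (j ℕ.* 2))) ≈ ∏< (M ℕ.* 2) f
∏<-pairs zero    f = λ _ → refl
∏<-pairs (suc M) f = begin
  ∏< M (λ j → f (j ℕ.* 2) * f (suc (j ℕ.* 2))) * (x * y)  ≈⟨ *-congʳ {∏< M (λ j → f (j ℕ.* 2) * f (suc (j ℕ.* 2)))} (x * y) (∏<-pairs M f) ⟩
  ∏< (M ℕ.* 2) f * (x * y)                                ≈⟨ *-assoc (∏< (M ℕ.* 2) f) x y ⟨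
  ∏< (M ℕ.* 2) f * x * y                                  ∎
  where
  open ≈-Reasoning
  x = f (M ℕ.* 2)
  y = f (suc (M ℕ.* 2))

-- The bound chosen by `∏-converges` at degree k is `suc k`, so k < M says precisely that M lies in
-- the stable range.
∏∞-truncate : ∀ f f≡1 {M} k → k < M → ∏∞ f (∏-converges f f≡1) k ≡ ∏< M f k
∏∞-truncate f f≡1 {M} k k<M = sym (proj₂ (∏-converges f f≡1 k) M k<M)

qPochhammer-truncate : ∀ z w w₀ {M} k → k < M →
                       qPochhammer z w w₀ k ≡ ∏< M (λ i → 1# - z * w ^ i) k
qPochhammer-truncate z w w₀ {M} k k<M = sym (proj₂ (qPochhammer-converges z w w₀ k) M k<M)

-- Pochhammer factors as binomials in powers of `q`.

q^-progression : ∀ a m j → q ^ (a ℕ.+ j ℕ.* m) ≈ q ^ a * (q ^ m) ^ j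
q^-progression a m j = begin
  q ^ (a ℕ.+ j ℕ.* m)    ≈⟨ ^-distribˡ-+-* q a (j ℕ.* m) ⟩
  q ^ a * q ^ (j ℕ.* m)  ≈⟨ *-congˡ (q ^ a) (^-*-assoc q m j) ⟩
  q ^ a * (q ^ m) ^ j    ∎
  where open ≈-Reasoning

1-q^-factor : ∀ b m j → 1# - q ^ b * (q ^ m) ^ j ≈ 1# - q ^ (b ℕ.+ j ℕ.* m)
1-q^-factor b m j n = cong (ℤ._-_ (1# n)) (sym (q^-progression b m j n))

1+q^-factor : ∀ a m j → 1# - (- (q ^ a)) * (q ^ m) ^ j ≈ 1# + q ^ (a ℕ.+ j ℕ.* m)
1+q^-factor a m j n = cong (ℤ._+_ (1# n)) (trans
  (cong ℤ.-_ (*-negˡ (q ^ a) ((q ^ m) ^ j) n))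
  (trans (ℤ.neg-involutive _) (sym (q^-progression a m j n))))

-- Series congruent to 1 modulo a power of `q`.

q^-vanishes : ∀ n k → k < n → (q ^ n) k ≡ 0ℤ
q^-vanishes = ^-vanishes {q} refl

1+q^-low : ∀ n k → k < n → (1# + q ^ n) k ≡ 1# k
1+q^-low n k k<n = trans (cong (ℤ._+_ (1# k)) (q^-vanishes n k k<n)) (ℤ.+-identityʳ (1# k))

1-q^-low : ∀ n k → k < n → (1# - q ^ n) k ≡ 1# k
1-q^-low n k k<n = trans (cong (ℤ._-_ (1# k)) (q^-vanishes n k k<n)) (ℤ.+-identityʳ (1# k))

*-low : ∀ {f g n} → (∀ k → k < n → f k ≡ 1# k) → (∀ k → k < n → g k ≡ 1# k) →
        ∀ k → k < n → (f * g) k ≡ 1# k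
*-low {f} f≡1 g≡1 k k<n = trans
  (*-cong-≤ {f} k (λ i i≤k → f≡1 i (ℕ.≤-<-trans i≤k k<n)) (λ i i≤k → g≡1 i (ℕ.≤-<-trans i≤k k<n)))
  (*-identityʳ 1# k)

module _ (A B : ℕ) .{{_ : NonZero A}} .{{_ : NonZero B}} where

  R-denominator : PowerSeries
  R-denominator = (1# + q ^ A) * (1# - q ^ B)

  R-*-denominator : R A B * R-denominator ≈ 1# + q ^ (A ℕ.+ B)
  R-*-denominator = /-* (1# + q ^ (A ℕ.+ B)) R-denominator
    (*-const-1 {1# + q ^ A} {1# - q ^ B}
      (cong (ℤ._+_ 1ℤ) (q^-const A)) (cong (ℤ._-_ 1ℤ) (q^-const B)))

  -- The long division is never unfolded: modulo qⁿ the denominator is 1, so `R A B` agrees there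
  -- with `R A B * R-denominator`, which is the numerator and is itself 1 modulo qⁿ.
  R-low : ∀ n → n ≤ A → n ≤ B → ∀ k → k < n → R A B k ≡ 1# k
  R-low n n≤A n≤B k k<n = begin
    R A B k                    ≡⟨ *-identityʳ (R A B) k ⟨
    (R A B * 1#) k             ≡⟨ *-cong-≤ {R A B} k (λ _ _ → refl)
                                    (λ i i≤k → sym (denominator-low i (ℕ.≤-<-trans i≤k k<n))) ⟩
    (R A B * R-denominator) k  ≡⟨ R-*-denominator k ⟩
    (1# + q ^ (A ℕ.+ B)) k     ≡⟨ 1+q^-low (A ℕ.+ B) k
                                    (ℕ.<-≤-trans k<n (ℕ.≤-trans n≤A (ℕ.m≤m+n A B))) ⟩
    1# k                       ∎
    where
    open ≡-Reasoning
    denominator-low : ∀ i → i < n → R-denominator i ≡ 1# i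
    denominator-low = *-low {1# + q ^ A} {1# - q ^ B}
      (λ i i<n → 1+q^-low A i (ℕ.<-≤-trans i<n n≤A))
      (λ i i<n → 1-q^-low B i (ℕ.<-≤-trans i<n n≤B))

-- Since m ≥ 1, exponents along the progression grow at least as fast as the index. This makes the
-- j-th factor 1 below degree j, as `∏-converges` requires.
j≤a+j*m : ∀ a m j .{{_ : NonZero m}} → j ≤ a ℕ.+ j ℕ.* m
j≤a+j*m a m j = ℕ.≤-trans (ℕ.m≤m*n j m) (ℕ.m≤n+m (j ℕ.* m) a)

-- The factorisation of `F a b m`.

module _ (a b m : ℕ) .{{_ : NonZero a}} .{{_ : NonZero b}} .{{_ : NonZero m}} where

  private
    A B C : ℕ → ℕ
    A j = a ℕ.+ j ℕ.* m
    B j = b ℕ.+ j ℕ.* m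
    C j = a ℕ.+ b ℕ.+ j ℕ.* m

    Rⱼ Sⱼ : ℕ → PowerSeries
    Rⱼ j = R (A j) (B j)
    Sⱼ j = 1# + q ^ C (2 ℕ.* j ℕ.+ 1)

    w : PowerSeries
    w = q ^ m

    w₀ : w 0 ≡ 0ℤ
    w₀ = q^-const m

    -- Kept in the shape that `qPochhammer` multiplies, signs unsimplified, so that its truncations
    -- are literally `∏< M α`, `∏< M β` and `∏< M γ`.
    α β γ : ℕ → PowerSeries
    α j = 1# - (- (q ^ a)) * w ^ j
    β j = 1# - q ^ b * w ^ j
    γ j = 1# - (- (q ^ (a ℕ.+ b))) * w ^ j

    α∞ β∞ γ∞ : PowerSeries
    α∞ = qPochhammer (- (q ^ a)) w w₀
    β∞ = qPochhammer (q ^ b) w w₀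
    γ∞ = qPochhammer (- (q ^ (a ℕ.+ b))) w w₀

    αβ∞-const : (α∞ * β∞) 0 ≡ 1ℤ
    αβ∞-const = *-const-1 {α∞} {β∞}
      (qPochhammer-const (- (q ^ a)) w w₀ (-q^-const a))
      (qPochhammer-const (q ^ b) w w₀ (q^-const b))

  Rⱼ-low : ∀ j k → k < j → Rⱼ j k ≡ 1# k
  Rⱼ-low j = R-low (A j) (B j) j (j≤a+j*m a m j) (j≤a+j*m b m j)

  Sⱼ-low : ∀ j k → k < j → Sⱼ j k ≡ 1# k
  Sⱼ-low j k k<j = 1+q^-low (C (2 ℕ.* j ℕ.+ 1)) k (ℕ.<-≤-trans k<j
    (ℕ.≤-trans (ℕ.≤-trans (ℕ.m≤n*m j 2) (ℕ.m≤m+n (2 ℕ.* j) 1))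
      (j≤a+j*m (a ℕ.+ b) m (2 ℕ.* j ℕ.+ 1))))

  Rⱼ-convergent : ProductConverges Rⱼ
  Rⱼ-convergent = ∏-converges Rⱼ Rⱼ-low

  Sⱼ-convergent : ProductConverges Sⱼ
  Sⱼ-convergent = ∏-converges Sⱼ Sⱼ-low

  Rⱼ-factor : ∀ j → Rⱼ j * (α j * β j) ≈ γ (j ℕ.* 2)
  Rⱼ-factor j = begin
    Rⱼ j * (α j * β j)                 ≈⟨ *-congˡ (Rⱼ j) (*-cong {α j} (1+q^-factor a m j) (1-q^-factor b m j)) ⟩
    Rⱼ j * R-denominator (A j) (B j)   ≈⟨ R-*-denominator (A j) (B j) ⟩
    1# + q ^ (A j ℕ.+ B j)             ≡⟨ cong (λ n → 1# + q ^ n) (exponent a b m j) ⟩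
    1# + q ^ C (j ℕ.* 2)               ≈⟨ 1+q^-factor (a ℕ.+ b) m (j ℕ.* 2) ⟨
    γ (j ℕ.* 2)                        ∎
    where
    open ≈-Reasoning
    exponent : ∀ a b m j → a ℕ.+ j ℕ.* m ℕ.+ (b ℕ.+ j ℕ.* m) ≡ a ℕ.+ b ℕ.+ j ℕ.* 2 ℕ.* m
    exponent = ℕSolver.solve-∀

  Sⱼ-factor : ∀ j → Sⱼ j ≈ γ (suc (j ℕ.* 2))
  Sⱼ-factor j = begin
    1# + q ^ C (2 ℕ.* j ℕ.+ 1)  ≡⟨ cong (λ n → 1# + q ^ C n) (index j) ⟩
    1# + q ^ C (suc (j ℕ.* 2))  ≈⟨ 1+q^-factor (a ℕ.+ b) m (suc (j ℕ.* 2)) ⟨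
    γ (suc (j ℕ.* 2))           ∎
    where
    open ≈-Reasoning
    index : ∀ j → 2 ℕ.* j ℕ.+ 1 ≡ suc (j ℕ.* 2)
    index = ℕSolver.solve-∀

  partial-products : ∀ M → ∏< M Rⱼ * ∏< M Sⱼ * (∏< M α * ∏< M β) ≈ ∏< (M ℕ.* 2) γ
  partial-products M = begin
    ∏< M Rⱼ * ∏< M Sⱼ * (∏< M α * ∏< M β)
      ≈⟨ *-congˡ (∏< M Rⱼ * ∏< M Sⱼ) (∏<-distrib-* M α β) ⟨
    ∏< M Rⱼ * ∏< M Sⱼ * ∏< M αβ
      -- Brings the denominator factors next to `Rⱼ`, so that the products merge into one that
      -- simplifies factor by factor.
      ≈⟨ xy∙z≈xz∙y (∏< M Rⱼ) (∏< M Sⱼ) (∏< M αβ) ⟩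
    ∏< M Rⱼ * ∏< M αβ * ∏< M Sⱼ
      ≈⟨ *-congʳ {∏< M (λ j → Rⱼ j * αβ j)} (∏< M Sⱼ) (∏<-distrib-* M Rⱼ αβ) ⟨
    ∏< M (λ j → Rⱼ j * αβ j) * ∏< M Sⱼ
      ≈⟨ ∏<-distrib-* M (λ j → Rⱼ j * αβ j) Sⱼ ⟨
    ∏< M (λ j → Rⱼ j * αβ j * Sⱼ j)
      ≈⟨ ∏<-cong M (λ j → *-cong {Rⱼ j * αβ j} (Rⱼ-factor j) (Sⱼ-factor j)) ⟩
    ∏< M (λ j → γ (j ℕ.* 2) * γ (suc (j ℕ.* 2)))
      ≈⟨ ∏<-pairs M γ ⟩
    ∏< (M ℕ.* 2) γ
      ∎
    where
    open ≈-Reasoning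
    αβ : ℕ → PowerSeries
    αβ j = α j * β j

  infinite-products : ∏∞ Rⱼ Rⱼ-convergent * ∏∞ Sⱼ Sⱼ-convergent * (α∞ * β∞) ≈ γ∞
  infinite-products n = begin
    (∏∞ Rⱼ Rⱼ-convergent * ∏∞ Sⱼ Sⱼ-convergent * (α∞ * β∞)) n
      ≡⟨ *-cong-≤ {∏∞ Rⱼ Rⱼ-convergent * ∏∞ Sⱼ Sⱼ-convergent} n
           (*-truncate (∏∞-truncate Rⱼ Rⱼ-low) (∏∞-truncate Sⱼ Sⱼ-low))
           (*-truncate (qPochhammer-truncate (- (q ^ a)) w w₀) (qPochhammer-truncate (q ^ b) w w₀)) ⟩
    (∏< M Rⱼ * ∏< M Sⱼ * (∏< M α * ∏< M β)) n
      ≡⟨ partial-products M n ⟩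
    ∏< (M ℕ.* 2) γ n
      -- As M is `suc n`, the inequality M ≤ 2M is already n < 2M.
      ≡⟨ qPochhammer-truncate (- (q ^ (a ℕ.+ b))) w w₀ n (ℕ.m≤m*n M 2) ⟨
    γ∞ n
      ∎
    where
    open ≡-Reasoning
    M = suc n
    -- Agreement is needed at every k ≤ n, since coefficient n of the outer product involves all
    -- lower coefficients of its factors.
    *-truncate : ∀ {f f′ g g′} → (∀ k → k < M → f k ≡ f′ k) → (∀ k → k < M → g k ≡ g′ k) →
                 ∀ k → k ≤ n → (f * g) k ≡ (f′ * g′) k
    *-truncate {f} f≡ g≡ k k≤n = *-cong-≤ {f} k
      (λ i i≤k → f≡ i (s≤s (ℕ.≤-trans i≤k k≤n)))
      (λ i i≤k → g≡ i (s≤s (ℕ.≤-trans i≤k k≤n)))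

  F≈∏∞Rⱼ*∏∞Sⱼ : F a b m ≈ ∏∞ Rⱼ Rⱼ-convergent * ∏∞ Sⱼ Sⱼ-convergent
  F≈∏∞Rⱼ*∏∞Sⱼ = *-cancelʳ (α∞ * β∞) αβ∞-const (begin
    -- `F a b m` unfolds to the quotient of `γ∞` by `α∞ * β∞`. Its constant-term proof is an
    -- irrelevant argument, so `αβ∞-const` can stand in for it.
    F a b m * (α∞ * β∞)                                    ≈⟨ /-* γ∞ (α∞ * β∞) αβ∞-const ⟩
    γ∞                                                     ≈⟨ infinite-products ⟨
    ∏∞ Rⱼ Rⱼ-convergent * ∏∞ Sⱼ Sⱼ-convergent * (α∞ * β∞)  ∎)
    where open ≈-Reasoning

proposition2p2 : (a b m : ℕ) .{{_ : NonZero a}} .{{_ : NonZero b}} .{{_ : NonZero m}} →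
    let Rⱼ = λ j → R (a ℕ.+ j ℕ.* m) (b ℕ.+ j ℕ.* m)
        C  = λ j → a ℕ.+ b ℕ.+ j ℕ.* m
        Sⱼ = λ j → 1# + q ^ C (2 ℕ.* j ℕ.+ 1)
    in
    Σ[ convR ∈ ProductConverges Rⱼ ]
    Σ[ convS ∈ ProductConverges Sⱼ ]
    F a b m ≈ ∏∞ Rⱼ convR * ∏∞ Sⱼ convS
proposition2p2 a b m = Rⱼ-convergent a b m , Sⱼ-convergent a b m , F≈∏∞Rⱼ*∏∞Sⱼ a b m
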